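{- Let $n\geq 2$ and let $a_1,\ldots,a_n\in\mathbb Z$. Consider the congruence $a_1x_1+\ldots+a_nx_n\equiv 1\pmod n$. (1) If $n$ is odd or some $a_i$ is even, then the congruence has a solution $(x_1,\ldots,x_n)\in\mathbb Z^n$ with the $x_i$ pairwise distinct modulo $n$ if and only if $\gcd(a_2-a_1,a_3-a_1,\ldots,a_n-a_1,n)=1$. (2) If $n\equiv 0\pmod 4$ and all $a_i$ are odd, then the congruence has no solution $(x_1,\ldots,x_n)\in\mathbb Z^n$ with the $x_i$ pairwise distinct modulo $n$. (3) If $n\equiv 2\pmod 4$ and all $a_i$ are odd, then the congruence has a solution $(x_1,\ldots,x_n)\in\mathbb Z^n$ with the $x_i$ pairwise distinct modulo $n$ if and only if $\gcd(a_2-a_1,a_3-a_1,\ldots,a_n-a_1,n)=2$. -}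

module Defs where

open import Data.Nat as ℕ using (ℕ; zero; suc; _<_; s≤s; z≤n)
open import Data.Integer as ℤ using (ℤ; +_; _-_; _*_; _+_)
open import Data.Integer.Divisibility using (_∣_)
open import Data.Integer.GCD using (gcd)
open import Data.Fin using (Fin; fromℕ<)
open import Data.List using (List; foldr; map)
open import Data.List.Base using (allFin)
open import Relation.Binary.PropositionalEquality using (_≢_)
open import Relation.Nullary using (¬_)
open import Data.Product using (_×_; ∃)

_≡_[mod_] : ℤ → ℤ → ℕ → Set
x ≡ y [mod n ] = (+ n) ∣ (x - y)

linSum : (n : ℕ) → (Fin n → ℤ) → (Fin n → ℤ) → ℤ
linSum n a x = foldr _+_ (+ 0) (map (λ i → a i * x i) (allFin n))

PairwiseDistinctMod : (n : ℕ) → (Fin n → ℤ) → Set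
PairwiseDistinctMod n x = ∀ (i j : Fin n) → i ≢ j → ¬ (x i ≡ x j [mod n ])

HasDistinctSolution : (n : ℕ) → (Fin n → ℤ) → Set
HasDistinctSolution n a =
  ∃ λ x → PairwiseDistinctMod n x × (linSum n a x ≡ + 1 [mod n ])

first : (n : ℕ) → 0 < n → Fin n
first n p = fromℕ< p

-- gcd(a_2 - a_1, ..., a_n - a_1, n)  (the term a_1 - a_1 = 0 is also included,
-- which does not change the gcd); a non-negative integer
gcdDiff : (n : ℕ) → 0 < n → (Fin n → ℤ) → ℤ
gcdDiff n p a = foldr (λ i g → gcd (a i - a (first n p)) g) (+ n) (allFin n)

Even Odd : ℤ → Set
Even z = (+ 2) ∣ z
Odd z = ¬ Even z

{-# OPTIONS --safe #-}
module Submission where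

-- Scaling x by a unit scales the sum, so it suffices to find a bijection x onto ℤ/n for which
-- w = Σ aᵢ xᵢ is prime to n.  Read x backwards, as an arrangement f of the weights on ℤ/n; exchanging
-- the weights at z and z + d adds d (f z - f (z + d)) to w.  Let D_q be the q-free part of n, so
-- that an exchange at distance D_q affects w only modulo q.  Treat the primes p ∣ n in increasing
-- order, keeping w prime to the smaller ones.  Suppose p ∣ w.
--   * If D_p is not a period of f mod p, one exchange at distance D_p makes w prime to p.
--   * Otherwise, as the D_q have gcd 1 and f is not constant mod p, some D_q with q ≠ p is not a
--     period, say f z ≢ f (z + D_q) mod p.  Exchanging these two weights, or those at z + D_p and
--     z + D_p + D_q, or doing both, keeps w prime to q (if q < p), and destroys the period D_p.
-- If all aᵢ are odd and n ≡ 2 mod 4, then w is odd for every arrangement, so p = 2 needs no step.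
-- Conversely Σ aᵢ xᵢ ≡ a₁ n(n-1)/2 modulo the gcd d of n and the differences, whence d ∣ 2.

open import Defs
open import Data.Bool using (if_then_else_)
open import Data.Empty using (⊥-elim)
open import Data.Fin using (Fin; toℕ; fromℕ<; zero; suc)
open import Data.Fin.Permutation using (Permutation′; _⟨$⟩ʳ_; _⟨$⟩ˡ_; _∘ₚ_; transpose; inverseˡ; inverseʳ; permutation)
import Data.Fin.Permutation as Perm
import Data.Fin.Permutation.Components as PC
open import Data.Fin.Properties using (_≟_; toℕ-fromℕ<; toℕ-injective; toℕ<n; ¬∀⟶∃¬; all?; any?; injective⇒≤; punchOut-injective)
open import Data.Integer using (ℤ; +_; -[1+_]; -_; _+_; _*_; _-_; 0ℤ; 1ℤ) renaming (∣_∣ to abs)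
open import Data.Integer.DivMod using (_%ℕ_; _/ℕ_; n%ℕd<d; a≡a%ℕn+[a/ℕn]*n)
import Data.Integer.Properties as ℤ
open import Data.Integer.Divisibility.Signed
open import Data.Integer.GCD using (gcd; gcd[i,j]∣i; gcd[i,j]∣j; gcd-greatest)
open import Data.Integer.Tactic.RingSolver using (solve-∀)
open import Data.List using (List; foldr; tabulate; allFin; []; _∷_)
open import Data.List.Membership.Propositional using (_∈_)
open import Data.List.Membership.Propositional.Properties using (∈-allFin)
open import Data.List.Relation.Unary.Any using (here; there)
open import Data.List.Properties using (map-tabulate)
open import Data.List.Relation.Unary.All using ([]; _∷_)
open import Data.Nat as ℕ using (ℕ; zero; suc; _≤_; _<_; _%_; s≤s; z≤n; NonZero)
open import Data.Nat.Coprimality using (Coprime; coprime-Bézout)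
open import Data.Nat.Divisibility using (divides; quotient; quotient-<; quotient≢0; m∣n⇒n≡quotient*m) renaming (_∣_ to _∣ℕ_; _∣?_ to _∣ℕ?_)
import Data.Nat.Divisibility as ℕ
open import Data.Nat.DivMod using (_mod_; _/_; m≡m%n+[m/n]*n; m%n<n; %-distribˡ-+; m%n%n≡m%n; m<n⇒m%n≡m; [m+n]%n≡m%n)
open import Data.Nat.GCD using (module Bézout; gcd[m,n]∣m; gcd[m,n]∣n; gcd-GCD)
import Data.Nat.GCD as ℕ
open import Data.Nat.Induction using (<-rec)
open import Data.Nat.Primality using (Prime; prime?; prime⇒nonTrivial; prime⇒irreducible; euclidsLemma; irreducible[2]; prime[2]; ¬prime[1])
open import Data.Nat.Primality.Factorisation using (factorise)
import Data.Nat.Properties as ℕ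
open import Data.Nat.Properties using (<-≤-trans)
open import Data.Product using (_×_; ∃; _,_; proj₁; proj₂)
open import Data.Sum using (_⊎_; inj₁; inj₂; [_,_]′)
open import Function using (_∘_; id; _$_)
open import Function.Bundles using (_⇔_; mk⇔)
open import Relation.Binary.PropositionalEquality using (_≡_; _≢_; refl; sym; trans; cong; cong₂; subst; module ≡-Reasoning)
open import Relation.Nullary using (¬_; Dec; yes; no; does; contradiction)

open import Algebra.Properties.Semiring.Sum ℤ.+-*-semiring using (sum; sum-cong-≗; sum-permute; ∑-distrib-+; *-distribˡ-sum)

-- Prime divisors, coprimality and prime-free parts

prime-factor : ∀ m → .{{NonZero m}} → m ≢ 1 → ∃ λ q → Prime q × q ∣ℕ m
prime-factor m m≢1 with factorise m
... | record { factors = [] ; isFactorisation = eq } = contradiction eq m≢1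
... | record { factors = q ∷ qs ; isFactorisation = eq ; factorsPrime = pr ∷ _ } =
  q , pr , subst (q ∣ℕ_) (sym eq) (ℕ.m∣m*n _)

prime∣prime⇒≡ : ∀ {p q} → Prime p → Prime q → p ∣ℕ q → p ≡ q
prime∣prime⇒≡ pp pq p∣q with prime⇒irreducible pq p∣q
... | inj₁ refl = contradiction pp ¬prime[1]
... | inj₂ p≡q  = p≡q

prime∤⇒coprime : ∀ m n → .{{NonZero n}} →
                 (∀ {p} → Prime p → p ∣ℕ n → ¬ p ∣ℕ m) → Coprime m n
prime∤⇒coprime m n h {d} (d∣m , d∣n) with d ℕ.≟ 1
... | yes d≡1 = d≡1
... | no  d≢1 with prime-factor d {{ℕ.≢-nonZero λ { refl → ℕ.≢-nonZero⁻¹ n (ℕ.0∣⇒≡0 d∣n) }}} d≢1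
...   | q , pq , q∣d = contradiction (ℕ.∣-trans q∣d d∣m) (h pq (ℕ.∣-trans q∣d d∣n))

-- The prototype of such a d is m with all factors q removed; only these two properties matter.
IsFreePart : ℕ → ℕ → ℕ → Set
IsFreePart q m d = ¬ q ∣ℕ d × (∀ {r} → Prime r → r ∣ℕ m → r ≢ q → r ∣ℕ d)

freePart : ∀ {q} → Prime q → ∀ m → .{{NonZero m}} → ∃ (IsFreePart q m)
freePart {q} pq m {{m≢0}} = <-rec P go m m≢0
  where
  P : ℕ → Set
  P m = .(NonZero m) → ∃ (IsFreePart q m)
  go : ∀ m → (∀ {k} → k < m → P k) → P m
  go m rec m≢0 with q ∣ℕ? m
  ... | no q∤m = m , q∤m , λ _ r∣m _ → r∣m
  ... | yes q∣m with rec (quotient-< q∣m {{prime⇒nonTrivial pq}} {{m≢0}}) (quotient≢0 q∣m {{m≢0}})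
  ...   | d , q∤d , h = d , q∤d , λ pr r∣m r≢q →
          [ (λ r∣k → h pr r∣k r≢q) , (λ r∣q → contradiction (prime∣prime⇒≡ pr pq r∣q) r≢q) ]′
            (euclidsLemma (quotient q∣m) q pr (subst (_ ∣ℕ_) (m∣n⇒n≡quotient*m q∣m) r∣m))

-- Divisibility and congruences in ℤ

∣ℕ⇒∣ : ∀ {d m} → d ∣ℕ m → + d ∣ + m
∣ℕ⇒∣ = ∣ᵤ⇒∣

∣-euclid : ∀ {p} → Prime p → ∀ i j → + p ∣ i * j → + p ∣ i ⊎ + p ∣ j
∣-euclid pp i j p∣ij with euclidsLemma (abs i) (abs j) pp (subst (_ ∣ℕ_) (ℤ.abs-* i j) (∣⇒∣ᵤ p∣ij))
... | inj₁ h = inj₁ (∣ᵤ⇒∣ h)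
... | inj₂ h = inj₂ (∣ᵤ⇒∣ h)

∣i-i : ∀ m i → m ∣ i - i
∣i-i m i = divides 0ℤ (trans (ℤ.+-inverseʳ i) (sym (ℤ.*-zeroˡ m)))

∣-−-sym : ∀ {m} i j → m ∣ i - j → m ∣ j - i
∣-−-sym i j h = subst (_ ∣_) (eq i j) (∣m⇒∣-m h)
  where
  eq : ∀ i j → - (i - j) ≡ j - i
  eq = solve-∀

∣-−-trans : ∀ {m} i j k → m ∣ i - j → m ∣ j - k → m ∣ i - k
∣-−-trans i j k h h′ = subst (_ ∣_) (eq i j k) (∣m∣n⇒∣m+n h h′)
  where
  eq : ∀ i j k → (i - j) + (j - k) ≡ i - k
  eq = solve-∀

∣-−-subst : ∀ {m} i j → m ∣ i - j → m ∣ j → m ∣ i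
∣-−-subst i j h h′ = subst (_ ∣_) (eq i j) (∣m∣n⇒∣m+n h h′)
  where
  eq : ∀ i j → (i - j) + j ≡ i
  eq = solve-∀

-- Finite sums and the effect of a transposition

foldr-tabulate : ∀ {n} (f : Fin n → ℤ) → foldr _+_ 0ℤ (tabulate f) ≡ sum f
foldr-tabulate {zero}  f = refl
foldr-tabulate {suc n} f = cong (_+_ (f zero)) (foldr-tabulate (f ∘ suc))

linSum≡sum : ∀ n a x → linSum n a x ≡ sum (λ i → a i * x i)
linSum≡sum n a x = trans (cong (foldr _+_ 0ℤ) (map-tabulate id f)) (foldr-tabulate f)
  where f = λ i → a i * x i

sum-∣ : ∀ {n m} (f g : Fin n → ℤ) → (∀ i → m ∣ f i - g i) → m ∣ sum f - sum g
sum-∣ {zero}  f g h = ∣i-i _ 0ℤ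
sum-∣ {suc n} f g h =
  subst (_ ∣_) (eq (f zero) (g zero) _ _) (∣m∣n⇒∣m+n (h zero) (sum-∣ (f ∘ suc) (g ∘ suc) (h ∘ suc)))
  where
  eq : ∀ a b c d → (a - b) + (c - d) ≡ (a + c) - (b + d)
  eq = solve-∀

-- Point masses for writing the two terms that a transposition changes. `does` computes through
-- `suc`, so `sum-at` follows by plain induction.
at : ∀ {n} → Fin n → ℤ → Fin n → ℤ
at u c w = if does (w ≟ u) then c else 0ℤ

sum-0 : ∀ n → sum {n} (λ _ → 0ℤ) ≡ 0ℤ
sum-0 zero    = refl
sum-0 (suc n) = trans (ℤ.+-identityˡ _) (sum-0 n)

sum-at : ∀ {n} (u : Fin n) c → sum (at u c) ≡ c
sum-at {suc n} zero c = trans (cong (_+_ c) (sum-0 n)) (ℤ.+-identityʳ c)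
sum-at (suc u)      c = trans (ℤ.+-identityˡ _) (sum-at u c)

moment : ∀ {n} → (Fin n → ℤ) → ℤ
moment f = sum (λ v → + toℕ v * f v)

-- Only the terms at `u` and `v` change, by `cᵤ` and `cᵥ`; when `u ≡ v`, both corrections are 0.
moment-transpose : ∀ {n} (f : Fin n → ℤ) u v →
  moment (f ∘ PC.transpose u v) ≡ moment f + (+ toℕ v - + toℕ u) * (f u - f v)
moment-transpose f u v = begin
  moment (f ∘ PC.transpose u v)
    ≡⟨ sum-cong-≗ pointwise ⟩
  sum (λ w → + toℕ w * f w + (at u cᵤ w + at v cᵥ w))
    ≡⟨ ∑-distrib-+ (λ w → + toℕ w * f w) (λ w → at u cᵤ w + at v cᵥ w) ⟩
  moment f + sum (λ w → at u cᵤ w + at v cᵥ w)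
    ≡⟨ cong (_+_ (moment f)) (trans (∑-distrib-+ (at u cᵤ) (at v cᵥ)) (cong₂ _+_ (sum-at u cᵤ) (sum-at v cᵥ))) ⟩
  moment f + (cᵤ + cᵥ)
    ≡⟨ cong (_+_ (moment f)) (collect (+ toℕ u) (+ toℕ v) (f u) (f v)) ⟩
  moment f + (+ toℕ v - + toℕ u) * (f u - f v) ∎
  where
  open ≡-Reasoning
  cᵤ = + toℕ u * (f v - f u)
  cᵥ = + toℕ v * (f u - f v)
  collect : ∀ u v x y → u * (y - x) + v * (x - y) ≡ (v - u) * (x - y)
  collect = solve-∀
  eq₁ : ∀ u x → u * x ≡ u * x + (u * (x - x) + u * (x - x))
  eq₁ = solve-∀
  eq₂ : ∀ u x y → u * y ≡ u * x + (u * (y - x) + 0ℤ)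
  eq₂ = solve-∀
  eq₃ : ∀ v x y → v * x ≡ v * y + (0ℤ + v * (x - y))
  eq₃ = solve-∀
  eq₄ : ∀ x → x ≡ x + (0ℤ + 0ℤ)
  eq₄ = solve-∀
  pointwise : ∀ w → + toℕ w * f (PC.transpose u v w) ≡ + toℕ w * f w + (at u cᵤ w + at v cᵥ w)
  pointwise w with w ≟ u
  pointwise w | yes refl with w ≟ v
  ... | yes refl = eq₁ (+ toℕ w) (f w)
  ... | no _     = eq₂ (+ toℕ w) (f w) (f v)
  pointwise w | no _ with w ≟ v
  ... | yes refl = eq₃ (+ toℕ w) (f u) (f w)
  ... | no _     = eq₄ (+ toℕ w * f w)

transpose-left : ∀ {n} (u v : Fin n) → PC.transpose u v u ≡ v
transpose-left u v with u ≟ u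
... | yes _  = refl
... | no u≢u = contradiction refl u≢u

transpose-other : ∀ {n} {u v w : Fin n} → w ≢ u → w ≢ v → PC.transpose u v w ≡ w
transpose-other {u = u} {v} {w} w≢u w≢v with w ≟ u
... | yes w≡u = contradiction w≡u w≢u
... | no _ with w ≟ v
...   | yes w≡v = contradiction w≡v w≢v
...   | no _    = refl

-- Residues and inverses modulo n

toℕ-mod : ∀ m n → .{{_ : NonZero n}} → toℕ (m mod n) ≡ m % n
toℕ-mod m n = toℕ-fromℕ< (m%n<n m n)

mod-∣ : ∀ {r} n → .{{_ : NonZero n}} → r ∣ℕ n → ∀ m → + r ∣ + toℕ (m mod n) - + m
mod-∣ {r} n r∣n m = ∣-−-sym (+ m) (+ toℕ (m mod n)) $
  subst (+ r ∣_) (sym eq) (∣n⇒∣m*n (+ (m / n)) (∣ℕ⇒∣ r∣n))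
  where
  cancel : ∀ x y → (x + y) - x ≡ y
  cancel = solve-∀
  eq : + m - + toℕ (m mod n) ≡ + (m / n) * + n
  eq = begin
    + m - + toℕ (m mod n)                           ≡⟨ cong₂ (λ x y → + x - + y) (m≡m%n+[m/n]*n m n) (toℕ-mod m n) ⟩
    + (m % n ℕ.+ (m / n) ℕ.* n) - + (m % n)         ≡⟨ cong (λ z → (+ (m % n) + z) - + (m % n)) (ℤ.pos-* (m / n) n) ⟩
    (+ (m % n) + + (m / n) * + n) - + (m % n)       ≡⟨ cancel (+ (m % n)) _ ⟩
    + (m / n) * + n                                 ∎
    where open ≡-Reasoning

mod-≡⇒∣ : ∀ {r} n → .{{_ : NonZero n}} → r ∣ℕ n → ∀ k m → k mod n ≡ m mod n → + r ∣ + k - + m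
mod-≡⇒∣ n r∣n k m eq = ∣-−-trans (+ k) (+ toℕ (m mod n)) (+ m)
  (subst (λ w → _ ∣ + k - + toℕ w) eq (∣-−-sym (+ toℕ (k mod n)) (+ k) (mod-∣ n r∣n k))) (mod-∣ n r∣n m)

%-≡⇒mod-≡ : ∀ n → .{{_ : NonZero n}} → ∀ k m → k % n ≡ m % n → k mod n ≡ m mod n
%-≡⇒mod-≡ n k m eq = toℕ-injective (trans (toℕ-mod k n) (trans eq (sym (toℕ-mod m n))))

∣-−⇒≡ : ∀ {n k m} → k < n → m < n → + n ∣ + k - + m → k ≡ m
∣-−⇒≡ {n} {k} {m} k<n m<n h =
  [ (λ k≤m → sym (below k≤m m<n (∣-−-sym (+ k) (+ m) h))) , (λ m≤k → below m≤k k<n h) ]′ (ℕ.≤-total k m)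
  where
  vanish : ∀ j → j < n → n ∣ℕ j → j ≡ 0
  vanish zero    _   _   = refl
  vanish (suc j) j<n n∣j = contradiction n∣j (ℕ.>⇒∤ j<n)
  below : ∀ {k m} → k ≤ m → m < n → + n ∣ + m - + k → m ≡ k
  below {k} {m} k≤m m<n h = ℕ.≤-antisym (ℕ.m∸n≡0⇒m≤n (vanish (m ℕ.∸ k) (ℕ.≤-<-trans (ℕ.m∸n≤m m k) m<n)
    (∣⇒∣ᵤ (subst (+ n ∣_) (trans (ℤ.m-n≡m⊖n m k) (ℤ.⊖-≥ k≤m)) h)))) k≤m

-- Bézout over ℕ has two sign patterns. In the second, `1 + x * m ≡ y * n` makes `- x` the inverse.
-- A negative `w` negates the inverse of its absolute value.
coprime⇒inverse : ∀ w n → Coprime (abs w) n → ∃ λ c → + n ∣ c * w - 1ℤ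
coprime⇒inverse w n coprime = signed w (unsigned (coprime-Bézout coprime))
  where
  eq₁ : ∀ y n → (1ℤ + y * n) - 1ℤ ≡ y * n
  eq₁ = solve-∀
  eq₂ : ∀ x m → - x * m - 1ℤ ≡ - (1ℤ + x * m)
  eq₂ = solve-∀
  eq₃ : ∀ c w → c * w - 1ℤ ≡ - c * - w - 1ℤ
  eq₃ = solve-∀
  unsigned : ∀ {m} → Bézout.Identity 1 m n → ∃ λ c → + n ∣ c * + m - 1ℤ
  unsigned {m} (Bézout.+- x y eq) = + x , divides (+ y) (begin
    + x * + m - 1ℤ             ≡⟨ cong (_- 1ℤ) (ℤ.pos-* x m) ⟨
    + (x ℕ.* m) - 1ℤ           ≡⟨ cong (λ k → + k - 1ℤ) eq ⟨
    1ℤ + + (y ℕ.* n) - 1ℤ      ≡⟨ cong (λ k → 1ℤ + k - 1ℤ) (ℤ.pos-* y n) ⟩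
    1ℤ + + y * + n - 1ℤ        ≡⟨ eq₁ (+ y) (+ n) ⟩
    + y * + n                  ∎)
    where open ≡-Reasoning
  unsigned {m} (Bézout.-+ x y eq) = - + x , subst (+ n ∣_) (sym (begin
    - + x * + m - 1ℤ           ≡⟨ eq₂ (+ x) (+ m) ⟩
    - (1ℤ + + x * + m)         ≡⟨ cong (λ k → - (1ℤ + k)) (ℤ.pos-* x m) ⟨
    - + (1 ℕ.+ x ℕ.* m)        ≡⟨ cong (λ k → - + k) eq ⟩
    - + (y ℕ.* n)              ∎)) (∣m⇒∣-m (∣ℕ⇒∣ (ℕ.n∣m*n y)))
    where open ≡-Reasoning
  signed : ∀ w → (∃ λ c → + n ∣ c * + abs w - 1ℤ) → ∃ λ c → + n ∣ c * w - 1ℤ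
  signed (+ m)    (c , h) = c , h
  signed -[1+ m ] (c , h) = - c , subst (+ n ∣_) (eq₃ c (+ suc m)) h

-- Periods modulo p

-- Functions on ℤ/n are read as functions on ℕ, so that a shift is plain addition.
Period : ℕ → (ℕ → ℤ) → ℕ → Set
Period p f g = ∀ z → + p ∣ f z - f (z ℕ.+ g)

Break : ℕ → (ℕ → ℤ) → ℕ → Set
Break p f g = ∃ λ z → ¬ + p ∣ f z - f (z ℕ.+ g)

module _ (p : ℕ) (f : ℕ → ℤ) where

  period-* : ∀ {g} → Period p f g → ∀ c → Period p f (c ℕ.* g)
  period-* per zero z =
    subst (λ w → + p ∣ f z - f w) (sym (ℕ.+-identityʳ z)) (∣i-i (+ p) (f z))
  period-* {g} per (suc c) z = ∣-−-trans (f z) (f (z ℕ.+ g)) (f (z ℕ.+ suc c ℕ.* g)) (per z)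
    (subst (λ w → + p ∣ f (z ℕ.+ g) - f w) (ℕ.+-assoc z g (c ℕ.* g)) (period-* per c (z ℕ.+ g)))

  -- Subtraction of periods: f(z) ≡ f(z + l) = f(z + d + k) ≡ f(z + d). The additive form fits the
  -- Bézout identities over ℕ.
  period-cancel : ∀ d {k l} → Period p f k → Period p f l → d ℕ.+ k ≡ l → Period p f d
  period-cancel d {k} {l} perₖ perₗ eq z =
    ∣-−-trans (f z) (f (z ℕ.+ l)) (f (z ℕ.+ d)) (perₗ z)
      (subst (λ w → + p ∣ f w - f (z ℕ.+ d)) (trans (ℕ.+-assoc z d k) (cong (z ℕ.+_) eq))
        (∣-−-sym (f (z ℕ.+ d)) (f (z ℕ.+ d ℕ.+ k)) (perₖ (z ℕ.+ d))))

  period-gcd : ∀ k l → Period p f k → Period p f l → Period p f (ℕ.gcd k l)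
  period-gcd k l perₖ perₗ with Bézout.identity (gcd-GCD k l)
  ... | Bézout.+- x y eq = period-cancel (ℕ.gcd k l) (period-* perₗ y) (period-* perₖ x) eq
  ... | Bézout.-+ x y eq = period-cancel (ℕ.gcd k l) (period-* perₖ x) (period-* perₗ y) eq

-- Arrangements of the coefficients on ℤ/n

module _ (n : ℕ) .{{_ : NonZero n}} (a : Fin n → ℤ) where

  opaque

    -- `π` sends a residue to the index placed there, so this is Σ aᵢ xᵢ for x the inverse of `π`,
    -- reindexed by the values of x.
    weight : Permutation′ n → ℤ
    weight π = moment (λ v → a (π ⟨$⟩ʳ v))

    entry : Permutation′ n → ℕ → ℤ
    entry π z = a (π ⟨$⟩ʳ (z mod n))

    swap : Permutation′ n → ℕ → ℕ → Permutation′ n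
    swap π y z = transpose (y mod n) (z mod n) ∘ₚ π

    weight-def : ∀ π → weight π ≡ moment (λ v → a (π ⟨$⟩ʳ v))
    weight-def π = refl

    entry-def : ∀ π z → entry π z ≡ a (π ⟨$⟩ʳ (z mod n))
    entry-def π z = refl

    weight-swap-≡ : ∀ π y z → weight (swap π y z) ≡
      weight π + (+ toℕ (z mod n) - + toℕ (y mod n)) * (entry π y - entry π z)
    weight-swap-≡ π y z = moment-transpose (λ v → a (π ⟨$⟩ʳ v)) (y mod n) (z mod n)

    entry-swap-left : ∀ π y z → entry (swap π y z) y ≡ entry π z
    entry-swap-left π y z = cong (λ w → a (π ⟨$⟩ʳ w)) (transpose-left (y mod n) (z mod n))

    -- Incongruence modulo `p` implies incongruence modulo `n`; the exchanges below control
    -- positions only modulo `p`.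
    entry-swap-other : ∀ {p} → p ∣ℕ n → ∀ π y z w → ¬ + p ∣ + w - + y → ¬ + p ∣ + w - + z →
                       entry (swap π y z) w ≡ entry π w
    entry-swap-other p∣n π y z w w≢y w≢z = cong (λ w → a (π ⟨$⟩ʳ w))
      (transpose-other (w≢y ∘ mod-≡⇒∣ n p∣n w y) (w≢z ∘ mod-≡⇒∣ n p∣n w z))

  entry-cong : ∀ π y z → y % n ≡ z % n → entry π y ≡ entry π z
  entry-cong π y z eq = trans (entry-def π y)
    (trans (cong (λ w → a (π ⟨$⟩ʳ w)) (%-≡⇒mod-≡ n y z eq)) (sym (entry-def π z)))

  -- The exact change involves the difference of the reduced positions, which agrees with `d` only
  -- modulo `n`. Hence a congruence modulo divisors of `n`.
  weight-swap : ∀ {r} → r ∣ℕ n → ∀ π z d →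
    + r ∣ weight (swap π z (z ℕ.+ d)) - (weight π + + d * (entry π z - entry π (z ℕ.+ d)))
  weight-swap {r} r∣n π z d = subst (+ r ∣_) (sym eq)
    (∣m⇒∣m*n δ (∣m∣n⇒∣m-n (mod-∣ n r∣n (z ℕ.+ d)) (mod-∣ n r∣n z)))
    where
    u v δ : ℤ
    u = + toℕ (z mod n)
    v = + toℕ ((z ℕ.+ d) mod n)
    δ = entry π z - entry π (z ℕ.+ d)
    rearrange : ∀ s u v z d δ → (s + (v - u) * δ) - (s + d * δ) ≡ ((v - (z + d)) - (u - z)) * δ
    rearrange = solve-∀
    eq : weight (swap π z (z ℕ.+ d)) - (weight π + + d * δ) ≡ ((v - + (z ℕ.+ d)) - (u - + z)) * δ
    eq = trans (cong (_- (weight π + + d * δ)) (weight-swap-≡ π z (z ℕ.+ d)))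
               (rearrange (weight π) u v (+ z) (+ d) δ)

  weight-swap-fixed : ∀ {r} → r ∣ℕ n → ∀ π z d → r ∣ℕ d → + r ∣ weight (swap π z (z ℕ.+ d)) - weight π
  weight-swap-fixed {r} r∣n π z d r∣d = subst (+ r ∣_) (eq (weight (swap π z (z ℕ.+ d))) (weight π) (+ d) (entry π z - entry π (z ℕ.+ d)))
    (∣m∣n⇒∣m+n (weight-swap r∣n π z d) (∣m⇒∣m*n (entry π z - entry π (z ℕ.+ d)) (∣ℕ⇒∣ r∣d)))
    where
    eq : ∀ s s₀ d δ → (s - (s₀ + d * δ)) + d * δ ≡ s - s₀
    eq = solve-∀

  period-n : ∀ p π → Period p (entry π) n
  period-n p π z = subst (λ x → + p ∣ entry π z - x)
    (entry-cong π z (z ℕ.+ n) (sym ([m+n]%n≡m%n z n))) (∣i-i (+ p) (entry π z))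

  entry-inverse : ∀ π i → entry π (toℕ (π ⟨$⟩ˡ i)) ≡ a i
  entry-inverse π i = trans (entry-def π (toℕ (π ⟨$⟩ˡ i))) (cong a (trans (cong (π ⟨$⟩ʳ_) (toℕ-injective
    (trans (toℕ-mod (toℕ (π ⟨$⟩ˡ i)) n) (m<n⇒m%n≡m (toℕ<n (π ⟨$⟩ˡ i)))))) (inverseʳ π)))

  period-1⇒constant : ∀ p π → Period p (entry π) 1 → ∀ i j → + p ∣ a i - a j
  period-1⇒constant p π per i j =
    ∣-−-trans (a i) (entry π 0) (a j) (∣-−-sym (entry π 0) (a i) (from-0 i)) (from-0 j)
    where
    from-0 : ∀ i → + p ∣ entry π 0 - a i
    from-0 i = subst (λ x → + p ∣ entry π 0 - x)
      (trans (cong (entry π) (ℕ.*-identityʳ (toℕ (π ⟨$⟩ˡ i)))) (entry-inverse π i))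
      (period-* p (entry π) per (toℕ (π ⟨$⟩ˡ i)) 0)

  -- Entries repeat with period `n`, so testing `n` positions decides the matter and yields a
  -- witness.
  period-or-break : ∀ p π g → Period p (entry π) g ⊎ Break p (entry π) g
  period-or-break p π g with all? dec
    where
    dec : ∀ (w : Fin n) → Dec (+ p ∣ entry π (toℕ w) - entry π (toℕ w ℕ.+ g))
    dec w = + p ∣? entry π (toℕ w) - entry π (toℕ w ℕ.+ g)
  ... | yes all = inj₁ λ z → subst (+ p ∣_)
          (cong₂ _-_ (entry-cong π _ z (reduce z)) (entry-cong π _ (z ℕ.+ g) (reduce-+ z))) (all (z mod n))
    where
    reduce : ∀ z → toℕ (z mod n) % n ≡ z % n
    reduce z = trans (cong (_% n) (toℕ-mod z n)) (m%n%n≡m%n z n)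
    reduce-+ : ∀ z → (toℕ (z mod n) ℕ.+ g) % n ≡ (z ℕ.+ g) % n
    reduce-+ z = begin
      (toℕ (z mod n) ℕ.+ g) % n           ≡⟨ %-distribˡ-+ (toℕ (z mod n)) g n ⟩
      (toℕ (z mod n) % n ℕ.+ g % n) % n   ≡⟨ cong (λ y → (y ℕ.+ g % n) % n) (reduce z) ⟩
      (z % n ℕ.+ g % n) % n               ≡⟨ %-distribˡ-+ z g n ⟨
      (z ℕ.+ g) % n                       ∎
      where open ≡-Reasoning
  ... | no ¬all with ¬∀⟶∃¬ n _ (λ w → + p ∣? entry π (toℕ w) - entry π (toℕ w ℕ.+ g)) ¬all
  ...   | w , ¬h = inj₂ (toℕ w , ¬h)

  -- Descent on the period g: if q ∣ g and the q-free part d of n is also a period, so is gcd g d < g;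
  -- the descent cannot reach 1.
  break-below : ∀ p π → ¬ (∀ i j → + p ∣ a i - a j) → ∀ g → Period p (entry π) g → g ∣ℕ n →
    ∃ λ q → Prime q × q ∣ℕ g × ∃ λ d → IsFreePart q n d × Break p (entry π) d
  break-below p π nonconst = <-rec P go
    where
    P : ℕ → Set
    P g = Period p (entry π) g → g ∣ℕ n → ∃ λ q → Prime q × q ∣ℕ g × ∃ λ d → IsFreePart q n d × Break p (entry π) d
    go : ∀ g → (∀ {k} → k < g → P k) → P g
    go g rec per g∣n with g ℕ.≟ 1
    ... | yes refl = ⊥-elim (nonconst (period-1⇒constant p π per))
    ... | no g≢1 with prime-factor g {{g≢0}} g≢1
      where
      g≢0 : NonZero g
      g≢0 = ℕ.≢-nonZero λ { refl → ℕ.≢-nonZero⁻¹ n (ℕ.0∣⇒≡0 g∣n) }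
    ...   | q , pq , q∣g with freePart pq n
    ...     | d , free@(q∤d , _) with period-or-break p π d
    ...       | inj₂ brk  = q , pq , q∣g , d , free , brk
    ...       | inj₁ perd with rec smaller (period-gcd p (entry π) g d per perd) (ℕ.∣-trans (gcd[m,n]∣m g d) g∣n)
      where
      -- Equality would give q ∣ g ∣ d, but `d` is prime to `q`.
      smaller : ℕ.gcd g d < g
      smaller = ℕ.≤∧≢⇒<
        (ℕ.∣⇒≤ {{ℕ.≢-nonZero λ { refl → ℕ.≢-nonZero⁻¹ n (ℕ.0∣⇒≡0 g∣n) }}} (gcd[m,n]∣m g d))
        (λ eq → q∤d (ℕ.∣-trans (subst (q ∣ℕ_) (sym eq) q∣g) (gcd[m,n]∣n g d)))
    ...         | r , pr , r∣ , rest = r , pr , ℕ.∣-trans r∣ (gcd[m,n]∣m g d) , rest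

  -- Making the weight prime to the primes dividing n, in increasing order

  UnitBelow : ℕ → Permutation′ n → Set
  UnitBelow k π = ∀ q → Prime q → q ∣ℕ n → q < k → ¬ + q ∣ weight π

  -- A step disturbs the weight modulo a single prime `q`, so only `q` has to be rechecked. The
  -- assumption on `π` leaves `q` out because `unit-swap` takes q = p, which divides the old weight.
  unitBelow-≢ : ∀ {k q} π ρ → (∀ r → Prime r → r ∣ℕ n → r < k → r ≢ q → ¬ + r ∣ weight π) →
    (∀ r → Prime r → r ∣ℕ n → r ≢ q → + r ∣ weight ρ - weight π) →
    (q < k → ¬ + q ∣ weight ρ) → UnitBelow k ρ
  unitBelow-≢ {k} {q} π ρ unit same q∤ρ r pr r∣n r<k r∣ρ with r ℕ.≟ q
  ... | yes refl = q∤ρ r<k r∣ρ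
  ... | no r≢q   = unit r pr r∣n r<k r≢q
    (∣-−-subst (weight π) (weight ρ) (∣-−-sym (weight ρ) (weight π) (same r pr r∣n r≢q)) r∣ρ)

  swap-same : ∀ {q d} → IsFreePart q n d → ∀ π z →
    ∀ r → Prime r → r ∣ℕ n → r ≢ q → + r ∣ weight (swap π z (z ℕ.+ d)) - weight π
  swap-same {d = d} free π z r pr r∣n r≢q = weight-swap-fixed r∣n π z d (proj₂ free pr r∣n r≢q)

  module _ {p : ℕ} (pp : Prime p) (p∣n : p ∣ℕ n) {d : ℕ} (free : IsFreePart p n d) where

    private
      p∤d : ¬ + p ∣ + d
      p∤d = proj₁ free ∘ ∣⇒∣ᵤ

    -- Modulo `p` the new weight is 0 + d δ, and `p` divides neither `d` nor the difference δ at the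
    -- break.
    unit-swap : ∀ π → UnitBelow p π → + p ∣ weight π → Break p (entry π) d → ∃ (UnitBelow (suc p))
    unit-swap π unit p∣w (z , ¬z) = ρ , unitBelow-≢ π ρ
      (λ r pr r∣n r<1+p r≢p → unit r pr r∣n (ℕ.≤∧≢⇒< (ℕ.≤-pred r<1+p) r≢p))
      (swap-same free π z) (λ _ → p∤ρ)
      where
      ρ : Permutation′ n
      ρ = swap π z (z ℕ.+ d)
      δ : ℤ
      δ = entry π z - entry π (z ℕ.+ d)
      eq : ∀ s s₀ t → (s - s₀) - (s - (s₀ + t)) ≡ t
      eq = solve-∀
      p∤ρ : ¬ + p ∣ weight ρ
      p∤ρ p∣ρ = [ p∤d , ¬z ]′ (∣-euclid pp (+ d) δ (subst (+ p ∣_) (eq (weight ρ) (weight π) (+ d * δ))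
        (∣m∣n⇒∣m-n (∣m∣n⇒∣m-n p∣ρ p∣w) (weight-swap p∣n π z d))))

    -- Here `d` plays the role of D_p and `e` that of D_q. As p ∣ e, exchanges at distance `e`
    -- preserve the weight modulo `p`.
    module _ (π : Permutation′ n) (unit : UnitBelow p π) (p∣w : + p ∣ weight π)
             (period : Period p (entry π) d)
             {q : ℕ} (pq : Prime q) (q∣n : q ∣ℕ n) (q≢p : q ≢ p) {e : ℕ} (freeₑ : IsFreePart q n e) where

      private
        p∣e : p ∣ℕ e
        p∣e = proj₂ freeₑ pp p∣n (q≢p ∘ sym)

        -- Separates positions modulo `p`, where `e` is 0 and `d` is not: `j` collects the nonzero
        -- part, `k` the vanishing one.
        apart : ∀ i {j k} → ¬ + p ∣ j → + p ∣ k → i ≡ j - k → ¬ + p ∣ i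
        apart i {j} {k} p∤j p∣k eq p∣i = p∤j (∣-−-subst j k (subst (+ p ∣_) eq p∣i) p∣k)

        eq₁ : ∀ z d → (z + d) - z ≡ d - 0ℤ
        eq₁ = solve-∀
        eq₂ : ∀ z d e → (z + d) - (z + e) ≡ d - e
        eq₂ = solve-∀
        eq₃ : ∀ z d e → ((z + d) + e) - z ≡ d - - e
        eq₃ = solve-∀
        eq₄ : ∀ z d e → ((z + d) + e) - (z + e) ≡ d - 0ℤ
        eq₄ = solve-∀
        eq₅ : ∀ z d → ((z + d) + d) - z ≡ (d + d) - 0ℤ
        eq₅ = solve-∀
        eq₆ : ∀ z d e → ((z + d) + d) - (z + e) ≡ (d + d) - e
        eq₆ = solve-∀

        p∣0 : + p ∣ 0ℤ
        p∣0 = ∣ℕ⇒∣ (p ℕ.∣0)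

        z+d≢z : ∀ z → ¬ + p ∣ + (z ℕ.+ d) - + z
        z+d≢z z = apart _ p∤d p∣0 (eq₁ (+ z) (+ d))

        z+d≢z+e : ∀ z → ¬ + p ∣ + (z ℕ.+ d) - + (z ℕ.+ e)
        z+d≢z+e z = apart _ p∤d (∣ℕ⇒∣ p∣e) (eq₂ (+ z) (+ d) (+ e))

        shifted : ∀ z → + p ∣ entry π (z ℕ.+ e) - entry π (z ℕ.+ d ℕ.+ e)
        shifted z = subst (λ y → + p ∣ entry π (z ℕ.+ e) - entry π y)
          (trans (ℕ.+-assoc z e d) (trans (cong (z ℕ.+_) (ℕ.+-comm e d)) (sym (ℕ.+-assoc z d e))))
          (period (z ℕ.+ e))

      -- After the exchange, position z carries f(z + e), while z + d still carries f(z + d) ≡ f(z).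
      -- So the period `d` is broken at z and `unit-swap` applies.
      unit-swap-other : ∀ z → ¬ + p ∣ entry π z - entry π (z ℕ.+ e) →
        (q < p → ¬ + q ∣ weight (swap π z (z ℕ.+ e))) → ∃ (UnitBelow (suc p))
      unit-swap-other z ¬z q∤ρ = unit-swap ρ
        (unitBelow-≢ π ρ (λ r pr r∣n r<p _ → unit r pr r∣n r<p) (swap-same freeₑ π z) q∤ρ)
        (∣-−-subst (weight ρ) (weight π) (weight-swap-fixed p∣n π z e p∣e) p∣w)
        (z , λ h → ¬z (∣-−-trans (entry π z) (entry π (z ℕ.+ d)) (entry π (z ℕ.+ e)) (period z)
          (∣-−-sym (entry π (z ℕ.+ e)) (entry π (z ℕ.+ d)) (subst (+ p ∣_) (cong₂ _-_
            (entry-swap-left π z (z ℕ.+ e))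
            (entry-swap-other p∣n π z (z ℕ.+ e) (z ℕ.+ d) (z+d≢z z) (z+d≢z+e z))) h))))
        where
        ρ : Permutation′ n
        ρ = swap π z (z ℕ.+ e)

      -- Both swaps together change the weight modulo q by the sum of the two changes; when each swap
      -- alone makes it 0, the result is minus the original weight.
      unit-swap-both : ∀ z → ¬ + p ∣ entry π z - entry π (z ℕ.+ e) → q < p →
        + q ∣ weight (swap π z (z ℕ.+ e)) →
        + q ∣ weight (swap π (z ℕ.+ d) (z ℕ.+ d ℕ.+ e)) → ∃ (UnitBelow (suc p))
      unit-swap-both z ¬z q<p q∣A q∣B = unit-swap C
        (unitBelow-≢ π C (λ r pr r∣n r<p _ → unit r pr r∣n r<p) same (λ _ → q∤C))
        (∣-−-subst (weight C) (weight π) (same p pp p∣n (q≢p ∘ sym)) p∣w)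
        -- The break is not sought at z: positions z and z + d now carry f(z + e) and f(z + d + e),
        -- which agree modulo `p`. Position z + 2d is untouched and carries a value congruent to
        -- f(z).
        (z ℕ.+ d , λ h → ¬z (break h))
        where
        A B C : Permutation′ n
        A = swap π z (z ℕ.+ e)
        B = swap π (z ℕ.+ d) (z ℕ.+ d ℕ.+ e)
        C = swap A (z ℕ.+ d) (z ℕ.+ d ℕ.+ e)

        same : ∀ r → Prime r → r ∣ℕ n → r ≢ q → + r ∣ weight C - weight π
        same r pr r∣n r≢q = ∣-−-trans (weight C) (weight A) (weight π)
          (swap-same freeₑ A (z ℕ.+ d) r pr r∣n r≢q) (swap-same freeₑ π z r pr r∣n r≢q)

        A[z+d] : entry A (z ℕ.+ d) ≡ entry π (z ℕ.+ d)
        A[z+d] = entry-swap-other p∣n π z (z ℕ.+ e) (z ℕ.+ d) (z+d≢z z) (z+d≢z+e z)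

        A[z+d+e] : entry A (z ℕ.+ d ℕ.+ e) ≡ entry π (z ℕ.+ d ℕ.+ e)
        A[z+d+e] = entry-swap-other p∣n π z (z ℕ.+ e) (z ℕ.+ d ℕ.+ e)
          (apart _ p∤d (∣m⇒∣-m (∣ℕ⇒∣ p∣e)) (eq₃ (+ z) (+ d) (+ e)))
          (apart _ p∤d p∣0 (eq₄ (+ z) (+ d) (+ e)))

        t : ℤ
        t = + e * (entry π (z ℕ.+ d) - entry π (z ℕ.+ d ℕ.+ e))

        weight-C : + q ∣ weight C - (weight A + t)
        weight-C = subst (λ x → + q ∣ weight C - (weight A + + e * x)) (cong₂ _-_ A[z+d] A[z+d+e])
          (weight-swap q∣n A (z ℕ.+ d) e)

        collect : ∀ w A B C t → ((A + B) - C) + ((C - (A + t)) - (B - (w + t))) ≡ w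
        collect = solve-∀

        q∤C : ¬ + q ∣ weight C
        q∤C q∣C = unit q pq q∣n q<p (subst (+ q ∣_)
          (collect (weight π) (weight A) (weight B) (weight C) t)
          (∣m∣n⇒∣m+n (∣m∣n⇒∣m-n (∣m∣n⇒∣m+n q∣A q∣B) q∣C)
            (∣m∣n⇒∣m-n weight-C (weight-swap q∣n π (z ℕ.+ d) e))))

        double : ∀ d → d + d ≡ + 2 * d
        double = solve-∀

        -- This is where the primes have to be treated in increasing order: 2 ≤ q < p.
        p∤2d : ¬ + p ∣ + d + + d
        p∤2d h = [ (λ p∣2 → ℕ.<⇒≱ q<p (ℕ.≤-trans (ℕ.∣⇒≤ (∣⇒∣ᵤ p∣2)) (ℕ.nonTrivial⇒n>1 q {{prime⇒nonTrivial pq}})))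
                 , p∤d ]′ (∣-euclid pp (+ 2) (+ d) (subst (+ p ∣_) (double (+ d)) h))

        C[z+d] : entry C (z ℕ.+ d) ≡ entry π (z ℕ.+ d ℕ.+ e)
        C[z+d] = trans (entry-swap-left A (z ℕ.+ d) (z ℕ.+ d ℕ.+ e)) A[z+d+e]

        C[z+2d] : entry C (z ℕ.+ d ℕ.+ d) ≡ entry π (z ℕ.+ d ℕ.+ d)
        C[z+2d] = trans
          (entry-swap-other p∣n A (z ℕ.+ d) (z ℕ.+ d ℕ.+ e) (z ℕ.+ d ℕ.+ d)
            (z+d≢z (z ℕ.+ d)) (z+d≢z+e (z ℕ.+ d)))
          (entry-swap-other p∣n π z (z ℕ.+ e) (z ℕ.+ d ℕ.+ d)
            (apart _ p∤2d p∣0 (eq₅ (+ z) (+ d)))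
            (apart _ p∤2d (∣ℕ⇒∣ p∣e) (eq₆ (+ z) (+ d) (+ e))))

        break : + p ∣ entry C (z ℕ.+ d) - entry C (z ℕ.+ d ℕ.+ d) → + p ∣ entry π z - entry π (z ℕ.+ e)
        break h = ∣-−-trans f₀ f₂ fₑ (∣-−-trans f₀ (entry π (z ℕ.+ d)) f₂ (period z) (period (z ℕ.+ d)))
          (∣-−-sym fₑ f₂ (∣-−-trans fₑ (entry π (z ℕ.+ d ℕ.+ e)) f₂
            (shifted z)
            (subst (+ p ∣_) (cong₂ _-_ C[z+d] C[z+2d]) h)))
          where
          f₀ f₂ fₑ : ℤ
          f₀ = entry π z
          f₂ = entry π (z ℕ.+ d ℕ.+ d)
          fₑ = entry π (z ℕ.+ e)

      -- If q > p, then `q` is still to be treated and the first exchange suffices. Otherwise the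
      -- period `d` carries the break from z to z + d, giving a second candidate; if both spoil `q`,
      -- they are combined.
      unit-break : Break p (entry π) e → ∃ (UnitBelow (suc p))
      unit-break (z , ¬z) with q ℕ.<? p
      ... | no q≮p = unit-swap-other z ¬z (λ q<p → contradiction q<p q≮p)
      ... | yes q<p with + q ∣? weight (swap π z (z ℕ.+ e))
                       | + q ∣? weight (swap π (z ℕ.+ d) (z ℕ.+ d ℕ.+ e))
      ...   | no q∤A  | _       = unit-swap-other z ¬z (λ _ → q∤A)
      ...   | yes q∣A | yes q∣B = unit-swap-both z ¬z q<p q∣A q∣B
      ...   | yes _   | no q∤B  = unit-swap-other (z ℕ.+ d) ¬z+d (λ _ → q∤B)
        where
        f₀ fₑ f₁ : ℤ
        f₀ = entry π z
        fₑ = entry π (z ℕ.+ e)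
        f₁ = entry π (z ℕ.+ d ℕ.+ e)
        ¬z+d : ¬ + p ∣ entry π (z ℕ.+ d) - entry π (z ℕ.+ d ℕ.+ e)
        ¬z+d h = ¬z (∣-−-trans f₀ f₁ fₑ (∣-−-trans f₀ (entry π (z ℕ.+ d)) f₁ (period z) h)
          (∣-−-sym fₑ f₁ (shifted z)))

  unit-step : ∀ {p} → Prime p → p ∣ℕ n → ¬ (∀ i j → + p ∣ a i - a j) →
    ∀ π → UnitBelow p π → + p ∣ weight π → ∃ (UnitBelow (suc p))
  unit-step {p} pp p∣n nonconst π unit p∣w with freePart pp n
  ... | d , free with period-or-break p π d
  ...   | inj₂ brk = unit-swap pp p∣n free π unit p∣w brk
  -- The descent starts from gcd n d, a period because `n` and `d` are. Its prime divisors divide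
  -- `d`, so they differ from `p`.
  ...   | inj₁ per with break-below p π nonconst (ℕ.gcd n d)
                          (period-gcd p (entry π) n d (period-n p π) per) (gcd[m,n]∣m n d)
  ...     | q , pq , q∣g , e , freeₑ , brk =
            unit-break pp p∣n free π unit p∣w per pq (ℕ.∣-trans q∣g (gcd[m,n]∣m n d))
              (λ { refl → proj₁ free (ℕ.∣-trans q∣g (gcd[m,n]∣n n d)) }) freeₑ brk

  -- Primes modulo which `a` is constant admit no useful exchange, so their weights must be units
  -- from the start. For gcd 1 there are no such primes; for gcd 2 the only one is 2.
  module _ (hyp : ∀ {p : ℕ} → Prime p → p ∣ℕ n → (∀ i j → + p ∣ a i - a j) → ∀ π → ¬ + p ∣ weight π) where

    unitBelow : ∀ k → ∃ (UnitBelow k)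
    unitBelow zero    = Perm.id , λ _ _ _ ()
    unitBelow (suc k) with unitBelow k
    ... | π , unit with prime? k | k ∣ℕ? n | + k ∣? weight π
    ...   | yes pk | yes k∣n | yes k∣w = unit-step pk k∣n (λ const → hyp pk k∣n const π k∣w) π unit k∣w
    ...   | no ¬pk | _       | _       = π , λ q pq q∣n q<1+k →
            unit q pq q∣n (ℕ.≤∧≢⇒< (ℕ.≤-pred q<1+k) λ { refl → ¬pk pq })
    ...   | yes _  | no k∤n  | _       = π , λ q pq q∣n q<1+k →
            unit q pq q∣n (ℕ.≤∧≢⇒< (ℕ.≤-pred q<1+k) λ { refl → k∤n q∣n })
    ...   | yes _  | yes _   | no k∤w  = π , λ q pq q∣n q<1+k q∣w →
            unit q pq q∣n (ℕ.≤∧≢⇒< (ℕ.≤-pred q<1+k) λ { refl → k∤w q∣w }) q∣w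

    coprime-weight : ∃ λ π → Coprime (abs (weight π)) n
    -- The bound `suc n` includes the case where `n` itself is prime.
    coprime-weight with unitBelow (suc n)
    ... | π , unit = π , prime∤⇒coprime (abs (weight π)) n
      λ pq q∣n q∣w → unit _ pq q∣n (s≤s (ℕ.∣⇒≤ q∣n)) (∣ᵤ⇒∣ q∣w)

    -- Scaling the inverse of `π` by the inverse `c` of its weight turns the sum into c w ≡ 1.
    -- Multiplying by w undoes the scaling, so the values stay distinct.
    hasSolution : HasDistinctSolution n a
    hasSolution with coprime-weight
    ... | π , coprime with coprime⇒inverse (weight π) n coprime
    ...   | c , n∣cw-1 = x , distinct , ∣⇒∣ᵤ (subst (λ y → + n ∣ y - 1ℤ) (sym sum≡) n∣cw-1)
      where
      x : Fin n → ℤ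
      x i = c * + toℕ (π ⟨$⟩ˡ i)

      cancel : ∀ c w u v → w * (c * u - c * v) - (c * w - 1ℤ) * (u - v) ≡ u - v
      cancel = solve-∀

      distinct : PairwiseDistinctMod n x
      distinct i j i≢j n∣ = i≢j (trans (sym (inverseʳ π)) (trans (cong (π ⟨$⟩ʳ_) (toℕ-injective
        (∣-−⇒≡ (toℕ<n (π ⟨$⟩ˡ i)) (toℕ<n (π ⟨$⟩ˡ j))
          (subst (+ n ∣_) (cancel c (weight π) (+ toℕ (π ⟨$⟩ˡ i)) (+ toℕ (π ⟨$⟩ˡ j)))
            (∣m∣n⇒∣m-n (∣n⇒∣m*n (weight π) (∣ᵤ⇒∣ n∣)) (∣m⇒∣m*n _ n∣cw-1)))))) (inverseʳ π)))

      reorder : ∀ a c v → a * (c * v) ≡ c * (v * a)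
      reorder = solve-∀

      sum≡ : linSum n a x ≡ c * weight π
      sum≡ = begin
        linSum n a x                                             ≡⟨ linSum≡sum n a x ⟩
        sum (λ i → a i * x i)                                    ≡⟨ sum-permute (λ i → a i * x i) π ⟩
        sum (λ v → a (π ⟨$⟩ʳ v) * x (π ⟨$⟩ʳ v))                  ≡⟨ sum-cong-≗ (λ v → trans
            (cong (λ w → a (π ⟨$⟩ʳ v) * (c * + toℕ w)) (inverseˡ π)) (reorder (a (π ⟨$⟩ʳ v)) c (+ toℕ v))) ⟩
        sum (λ v → c * (+ toℕ v * a (π ⟨$⟩ʳ v)))                 ≡⟨ *-distribˡ-sum c (λ v → + toℕ v * a (π ⟨$⟩ʳ v)) ⟨
        c * moment (λ v → a (π ⟨$⟩ʳ v))                          ≡⟨ cong (c *_) (weight-def π) ⟨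
        c * weight π                                             ∎
        where open ≡-Reasoning

-- Sums over complete residue systems

injective⇒permutation : ∀ {n} (f : Fin n → Fin n) → (∀ {i j} → f i ≡ f j → i ≡ j) →
                        ∃ λ (π : Permutation′ n) → ∀ i → π ⟨$⟩ʳ i ≡ f i
injective⇒permutation f inj =
  permutation f (proj₁ ∘ preimage f inj) (proj₂ ∘ preimage f inj) (λ i → inj (proj₂ (preimage f inj (f i)))) , λ _ → refl
  where
  preimage : ∀ {n} (f : Fin n → Fin n) → (∀ {i j} → f i ≡ f j → i ≡ j) → ∀ j → ∃ λ i → f i ≡ j
  preimage {suc n} f inj j with any? (λ i → f i ≟ j)
  ... | yes found = found
  -- Punching out a missed `j` would inject `Fin (suc n)` into `Fin n`.
  ... | no  none  = contradiction
    (injective⇒≤ (λ {x} {y} eq → inj (punchOut-injective (missed x) (missed y) eq))) ℕ.1+n≰n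
    where
    missed : ∀ i → j ≢ f i
    missed i j≡fi = none (i , sym j≡fi)

triangle : ℕ → ℤ
triangle n = sum {n} (λ v → + toℕ v)

2*triangle : ∀ n → + 2 * triangle n ≡ + n * (+ n - 1ℤ)
2*triangle zero    = refl
2*triangle (suc n) = begin
  + 2 * (0ℤ + sum {n} (λ v → 1ℤ + + toℕ v)) ≡⟨ cong (λ s → + 2 * (0ℤ + s)) (sum-1+ n (λ v → + toℕ v)) ⟩
  + 2 * (0ℤ + (+ n + triangle n))           ≡⟨ eq₁ (+ n) (triangle n) ⟩
  + 2 * + n + + 2 * triangle n              ≡⟨ cong (_+_ (+ 2 * + n)) (2*triangle n) ⟩
  + 2 * + n + + n * (+ n - 1ℤ)              ≡⟨ eq₂ (+ n) ⟩
  (1ℤ + + n) * ((1ℤ + + n) - 1ℤ)            ∎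
  where
  open ≡-Reasoning
  eq₀ : ∀ n x s → (1ℤ + x) + (n + s) ≡ (1ℤ + n) + (x + s)
  eq₀ = solve-∀
  eq₁ : ∀ n t → + 2 * (0ℤ + (n + t)) ≡ + 2 * n + + 2 * t
  eq₁ = solve-∀
  eq₂ : ∀ n → + 2 * n + n * (n - 1ℤ) ≡ (1ℤ + n) * ((1ℤ + n) - 1ℤ)
  eq₂ = solve-∀
  sum-1+ : ∀ n (f : Fin n → ℤ) → sum (λ v → 1ℤ + f v) ≡ + n + sum f
  sum-1+ zero    f = refl
  sum-1+ (suc n) f = trans (cong (_+_ (1ℤ + f zero)) (sum-1+ n (f ∘ suc))) (eq₀ (+ n) (f zero) (sum (f ∘ suc)))

%ℕ-∣ : ∀ i n → .{{_ : NonZero n}} → + n ∣ i - + (i %ℕ n)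
%ℕ-∣ i n = divides (i /ℕ n) (trans (cong (_- + (i %ℕ n)) (a≡a%ℕn+[a/ℕn]*n i n)) (eq (+ (i %ℕ n)) (i /ℕ n * + n)))
  where
  eq : ∀ r q → (r + q) - r ≡ q
  eq = solve-∀

-- The residues of the `x i` are a permutation of 0, ..., n - 1.
sum-distinct : ∀ n → .{{_ : NonZero n}} → ∀ x → PairwiseDistinctMod n x → + n ∣ sum x - triangle n
sum-distinct n x distinct =
  subst (λ s → + n ∣ sum x - s) (sym (trans (sum-permute (λ v → + toℕ v) π) (sum-cong-≗ (λ i → cong (λ v → + toℕ v) (π≡r i)))))
    (sum-∣ x (λ i → + toℕ (r i)) x-r)
  where
  r : Fin n → Fin n
  r i = fromℕ< (n%ℕd<d (x i) n)
  x-r : ∀ i → + n ∣ x i - + toℕ (r i)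
  x-r i = subst (λ k → + n ∣ x i - + k) (sym (toℕ-fromℕ< (n%ℕd<d (x i) n))) (%ℕ-∣ (x i) n)
  r-injective : ∀ {i j} → r i ≡ r j → i ≡ j
  r-injective {i} {j} eq with i ≟ j
  ... | yes i≡j = i≡j
  ... | no  i≢j = contradiction
    (∣⇒∣ᵤ (∣-−-trans (x i) (+ toℕ (r i)) (x j) (x-r i)
      (subst (λ v → + n ∣ + toℕ v - x j) (sym eq) (∣-−-sym (x j) (+ toℕ (r j)) (x-r j)))))
    (distinct i j i≢j)
  π : Permutation′ n
  π = proj₁ (injective⇒permutation r r-injective)
  π≡r : ∀ i → π ⟨$⟩ʳ i ≡ r i
  π≡r = proj₂ (injective⇒permutation r r-injective)

-- Modulo `d`, Σ aᵢ xᵢ ≡ c Σ xᵢ ≡ c T with T = n (n - 1) / 2. Used with c = a₀ for the gcd and c = 1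
-- for parity.
solution-∣ : ∀ n → .{{_ : NonZero n}} → ∀ a {d} c → d ∣ℕ n → (∀ i → + d ∣ a i - c) →
             HasDistinctSolution n a → + d ∣ c * triangle n - 1ℤ
solution-∣ n a {d} c d∣n a≡c (x , distinct , sol) =
  ∣-−-trans (c * triangle n) (linSum n a x) 1ℤ
    (∣-−-sym (linSum n a x) (c * triangle n) (∣-−-trans (linSum n a x) (c * sum x) (c * triangle n)
      (subst (+ d ∣_) (cong₂ _-_ (sym (linSum≡sum n a x)) (sym (*-distribˡ-sum c x)))
        (sum-∣ (λ i → a i * x i) (λ i → c * x i)
          (λ i → subst (+ d ∣_) (eq₁ (a i) c (x i)) (∣m⇒∣m*n (x i) (a≡c i)))))
      (subst (+ d ∣_) (eq₂ c (sum x) (triangle n))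
        (∣n⇒∣m*n c (∣-trans (∣ℕ⇒∣ d∣n) (sum-distinct n x distinct))))))
    (∣-trans (∣ℕ⇒∣ d∣n) (∣ᵤ⇒∣ sol))
  where
  eq₁ : ∀ a c x → (a - c) * x ≡ a * x - c * x
  eq₁ = solve-∀
  eq₂ : ∀ c s t → c * (s - t) ≡ c * s - c * t
  eq₂ = solve-∀

-- The greatest common divisor of the differences

module _ (n : ℕ) (n>0 : 0 < n) (a : Fin n → ℤ) where

  private
    a₀ : ℤ
    a₀ = a (first n n>0)

    -- `gcdDiff` over an arbitrary list, to allow induction.
    foldGcd : List (Fin n) → ℤ
    foldGcd = foldr (λ i g → gcd (a i - a₀) g) (+ n)

    foldGcd-nonneg : ∀ is → ∃ λ d → foldGcd is ≡ + d
    foldGcd-nonneg []       = n , refl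
    foldGcd-nonneg (i ∷ is) = _ , refl

    foldGcd∣n : ∀ is → foldGcd is ∣ + n
    foldGcd∣n []       = ∣-refl
    foldGcd∣n (i ∷ is) = ∣-trans (∣ᵤ⇒∣ (gcd[i,j]∣j (a i - a₀) (foldGcd is))) (foldGcd∣n is)

    foldGcd∣diff : ∀ {i is} → i ∈ is → foldGcd is ∣ a i - a₀
    foldGcd∣diff {is = i ∷ is} (here refl) = ∣ᵤ⇒∣ (gcd[i,j]∣i (a i - a₀) (foldGcd is))
    foldGcd∣diff {is = i ∷ is} (there i∈)  = ∣-trans (∣ᵤ⇒∣ (gcd[i,j]∣j (a i - a₀) (foldGcd is))) (foldGcd∣diff i∈)

    foldGcd-greatest : ∀ {c} → c ∣ + n → (∀ i → c ∣ a i - a₀) → ∀ is → c ∣ foldGcd is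
    foldGcd-greatest {c} c∣n c∣a []       = c∣n
    foldGcd-greatest {c} c∣n c∣a (i ∷ is) =
      ∣ᵤ⇒∣ (gcd-greatest {a i - a₀} {foldGcd is} {c} (∣⇒∣ᵤ (c∣a i)) (∣⇒∣ᵤ (foldGcd-greatest c∣n c∣a is)))

  gcdDiff-nonneg : ∃ λ d → gcdDiff n n>0 a ≡ + d
  gcdDiff-nonneg = foldGcd-nonneg (allFin n)

  gcdDiff∣n : gcdDiff n n>0 a ∣ + n
  gcdDiff∣n = foldGcd∣n (allFin n)

  gcdDiff∣diff : ∀ i → gcdDiff n n>0 a ∣ a i - a₀
  gcdDiff∣diff i = foldGcd∣diff (∈-allFin i)

  gcdDiff-greatest : ∀ {c} → c ∣ + n → (∀ i → c ∣ a i - a₀) → c ∣ gcdDiff n n>0 a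
  gcdDiff-greatest c∣n c∣a = foldGcd-greatest c∣n c∣a (allFin n)

  -- 2 = a₀ n (n - 1) - 2 (a₀ T - 1) with T = n (n - 1) / 2, and both terms are divisible by the gcd.
  gcdDiff-solution : .{{_ : NonZero n}} → HasDistinctSolution n a → gcdDiff n n>0 a ≡ + 1 ⊎ gcdDiff n n>0 a ≡ + 2
  gcdDiff-solution sol with gcdDiff-nonneg
  ... | d , g≡d = [ (λ d≡1 → inj₁ (trans g≡d (cong +_ d≡1))) , (λ d≡2 → inj₂ (trans g≡d (cong +_ d≡2))) ]′
    (irreducible[2] (∣⇒∣ᵤ d∣2))
    where
    d∣n : + d ∣ + n
    d∣n = subst (_∣ + n) g≡d gcdDiff∣n
    T : ℤ
    T = triangle n
    split : ∀ c n t → c * (n * (n - 1ℤ)) - + 2 * (c * t - 1ℤ) ≡ c * (n * (n - 1ℤ) - + 2 * t) + + 2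
    split = solve-∀
    0+2 : ∀ c x → c * (x - x) + + 2 ≡ + 2
    0+2 = solve-∀
    d∣2 : + d ∣ + 2
    d∣2 = subst (+ d ∣_)
      (trans (split a₀ (+ n) T)
        (trans (cong (λ x → a₀ * (+ n * (+ n - 1ℤ) - x) + + 2) (2*triangle n)) (0+2 a₀ (+ n * (+ n - 1ℤ)))))
      (∣m∣n⇒∣m-n (∣n⇒∣m*n a₀ (∣m⇒∣m*n (+ n - 1ℤ) d∣n))
        (∣n⇒∣m*n (+ 2) (solution-∣ n a a₀ (∣⇒∣ᵤ d∣n) (λ i → subst (_∣ a i - a₀) g≡d (gcdDiff∣diff i)) sol)))

-- Parity of triangular numbers and of weights

2∤1 : ¬ + 2 ∣ 1ℤ
2∤1 h with ∣⇒∣ᵤ h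
... | divides zero ()
... | divides (suc _) ()

odd⇒2∣-1 : ∀ i → Odd i → + 2 ∣ i - 1ℤ
odd⇒2∣-1 i odd = residue (i %ℕ 2) (n%ℕd<d i 2) (%ℕ-∣ i 2)
  where
  eq : ∀ i → i - 0ℤ ≡ i
  eq = solve-∀
  residue : ∀ r → r < 2 → + 2 ∣ i - + r → + 2 ∣ i - 1ℤ
  residue 0 _ h = contradiction (∣⇒∣ᵤ (subst (+ 2 ∣_) (eq i) h)) odd
  residue 1 _ h = h
  residue (suc (suc _)) (s≤s (s≤s ())) _

triangle-even : ∀ n → n % 4 ≡ 0 → + 2 ∣ triangle n
triangle-even n n%4≡0 = divides (k * (+ n - 1ℤ)) (ℤ.*-cancelˡ-≡ (+ 2) _ _ (begin
  + 2 * triangle n                 ≡⟨ 2*triangle n ⟩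
  + n * (+ n - 1ℤ)                 ≡⟨ cong (_* (+ n - 1ℤ)) n≡4k ⟩
  k * + 4 * (+ n - 1ℤ)             ≡⟨ eq k (+ n - 1ℤ) ⟩
  + 2 * (k * (+ n - 1ℤ) * + 2)     ∎))
  where
  open ≡-Reasoning
  k : ℤ
  k = + (n / 4)
  n≡4k : + n ≡ k * + 4
  n≡4k = trans (cong +_ (trans (m≡m%n+[m/n]*n n 4) (cong (ℕ._+ n / 4 ℕ.* 4) n%4≡0))) (ℤ.pos-* (n / 4) 4)
  eq : ∀ k m → k * + 4 * m ≡ + 2 * (k * m * + 2)
  eq = solve-∀

triangle-odd : ∀ n → n % 4 ≡ 2 → + 2 ∣ triangle n - 1ℤ
-- For n = 4k + 2, T = (2k + 1)(4k + 1) = 2k(4k + 3) + 1.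
triangle-odd n n%4≡2 = divides (k * (+ 4 * k + + 3)) (ℤ.*-cancelˡ-≡ (+ 2) _ _ (begin
  + 2 * (triangle n - 1ℤ)                         ≡⟨ eq₁ (triangle n) ⟩
  + 2 * triangle n - + 2                          ≡⟨ cong (_- + 2) (2*triangle n) ⟩
  + n * (+ n - 1ℤ) - + 2                          ≡⟨ cong (λ m → m * (m - 1ℤ) - + 2) n≡4k+2 ⟩
  (+ 2 + k * + 4) * ((+ 2 + k * + 4) - 1ℤ) - + 2  ≡⟨ eq₂ k ⟩
  + 2 * (k * (+ 4 * k + + 3) * + 2)               ∎))
  where
  open ≡-Reasoning
  k : ℤ
  k = + (n / 4)
  n≡4k+2 : + n ≡ + 2 + k * + 4
  n≡4k+2 = trans (cong +_ (trans (m≡m%n+[m/n]*n n 4) (cong (ℕ._+ n / 4 ℕ.* 4) n%4≡2)))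
                 (cong (_+_ (+ 2)) (ℤ.pos-* (n / 4) 4))
  eq₁ : ∀ t → + 2 * (t - 1ℤ) ≡ + 2 * t - + 2
  eq₁ = solve-∀
  eq₂ : ∀ k → (+ 2 + k * + 4) * ((+ 2 + k * + 4) - 1ℤ) - + 2 ≡ + 2 * (k * (+ 4 * k + + 3) * + 2)
  eq₂ = solve-∀

-- Odd coefficients are 1 modulo 2, so every arrangement has the parity of Σ v.
weight-parity : ∀ n → .{{_ : NonZero n}} → ∀ a → (∀ i → Odd (a i)) → ∀ π → + 2 ∣ weight n a π - triangle n
weight-parity n a odd π = subst (λ w → + 2 ∣ w - triangle n) (sym (weight-def n a π))
  (sum-∣ (λ v → + toℕ v * a (π ⟨$⟩ʳ v)) (λ v → + toℕ v)
    (λ v → subst (+ 2 ∣_) (eq (+ toℕ v) (a (π ⟨$⟩ʳ v))) (∣n⇒∣m*n (+ toℕ v) (odd⇒2∣-1 (a (π ⟨$⟩ʳ v)) (odd (π ⟨$⟩ʳ v))))))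
  where
  eq : ∀ v a → v * (a - 1ℤ) ≡ v * a - v
  eq = solve-∀

theorem4p2 : (n : ℕ) → (n≥2 : 2 ≤ n) → (a : Fin n → ℤ) →
    let n>0 : 0 < n
        n>0 = <-≤-trans (s≤s z≤n) n≥2
    in ((Odd (+ n) ⊎ ∃ (λ i → Even (a i))) →
          (HasDistinctSolution n a ⇔ (gcdDiff n n>0 a ≡ + 1)))
       × ((n % 4 ≡ 0) → (∀ i → Odd (a i)) → ¬ HasDistinctSolution n a)
       × ((n % 4 ≡ 2) → (∀ i → Odd (a i)) →
          (HasDistinctSolution n a ⇔ (gcdDiff n n>0 a ≡ + 2)))
theorem4p2 n n≥2 a =
  (λ h → mk⇔ (λ sol → [ id , (λ g≡2 → ⊥-elim (g≢2 h g≡2 sol)) ]′ (gcdDiff-solution n n>0 a sol)) solve₁) ,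
  no-solution ,
  (λ n%4≡2 odd → mk⇔
    (λ sol → [ (λ g≡1 → ⊥-elim (g≢1 n%4≡2 odd g≡1)) , id ]′ (gcdDiff-solution n n>0 a sol))
    (solve₃ n%4≡2 odd))
  where
  n>0 : 0 < n
  n>0 = <-≤-trans (s≤s z≤n) n≥2

  instance
    n≢0 : NonZero n
    n≢0 = ℕ.>-nonZero n>0

  a₀ : ℤ
  a₀ = a (first n n>0)

  const⇒∣gcdDiff : ∀ {p} → p ∣ℕ n → (∀ i j → + p ∣ a i - a j) → + p ∣ gcdDiff n n>0 a
  const⇒∣gcdDiff p∣n const = gcdDiff-greatest n n>0 a (∣ℕ⇒∣ p∣n) (λ i → const i (first n n>0))

  g≢2 : Odd (+ n) ⊎ ∃ (λ i → Even (a i)) → gcdDiff n n>0 a ≡ + 2 → ¬ HasDistinctSolution n a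
  g≢2 (inj₁ odd)        g≡2 _   = odd (∣⇒∣ᵤ (subst (_∣ + n) g≡2 (gcdDiff∣n n n>0 a)))
  -- With even differences, one even aᵢ makes a₀ even, and then a₀ T ≡ 1 is impossible modulo 2.
  g≢2 (inj₂ (i , even)) g≡2 sol = 2∤1 (∣-−-subst 1ℤ (a₀ * triangle n)
    (∣-−-sym (a₀ * triangle n) 1ℤ (solution-∣ n a a₀ (∣⇒∣ᵤ (subst (_∣ + n) g≡2 (gcdDiff∣n n n>0 a))) 2∣diff sol))
    (∣m⇒∣m*n (triangle n) (∣-−-subst a₀ (a i) (∣-−-sym (a i) a₀ (2∣diff i)) (∣ᵤ⇒∣ even))))
    where
    2∣diff : ∀ i → + 2 ∣ a i - a₀
    2∣diff i = subst (_∣ a i - a₀) g≡2 (gcdDiff∣diff n n>0 a i)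

  solve₁ : gcdDiff n n>0 a ≡ + 1 → HasDistinctSolution n a
  solve₁ g≡1 = hasSolution n a λ {p} pp p∣n const _ _ →
    ¬prime[1] (subst Prime (ℕ.∣1⇒≡1 (∣⇒∣ᵤ (subst (+ p ∣_) g≡1 (const⇒∣gcdDiff p∣n const)))) pp)

  no-solution : n % 4 ≡ 0 → (∀ i → Odd (a i)) → ¬ HasDistinctSolution n a
  no-solution n%4≡0 odd sol = 2∤1 (∣-−-subst 1ℤ (1ℤ * triangle n)
    (∣-−-sym (1ℤ * triangle n) 1ℤ (solution-∣ n a 1ℤ 2∣n (λ i → odd⇒2∣-1 (a i) (odd i)) sol))
    (∣n⇒∣m*n 1ℤ (triangle-even n n%4≡0)))
    where
    2∣n : 2 ∣ℕ n
    2∣n = ℕ.∣-trans (divides 2 refl) (ℕ.m%n≡0⇒n∣m n 4 n%4≡0)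

  2∣n : n % 4 ≡ 2 → 2 ∣ℕ n
  2∣n n%4≡2 = subst (2 ∣ℕ_) (sym (m≡m%n+[m/n]*n n 4))
    (ℕ.∣m∣n⇒∣m+n (subst (2 ∣ℕ_) (sym n%4≡2) ℕ.∣-refl) (ℕ.∣-trans (divides 2 refl) (ℕ.n∣m*n (n / 4))))

  g≢1 : n % 4 ≡ 2 → (∀ i → Odd (a i)) → gcdDiff n n>0 a ≢ + 1
  g≢1 n%4≡2 odd g≡1 = 2∤1 (subst (+ 2 ∣_) g≡1 (const⇒∣gcdDiff (2∣n n%4≡2) λ i j →
    ∣-−-trans (a i) 1ℤ (a j) (odd⇒2∣-1 (a i) (odd i)) (∣-−-sym (a j) 1ℤ (odd⇒2∣-1 (a j) (odd j)))))

  solve₃ : n % 4 ≡ 2 → (∀ i → Odd (a i)) → gcdDiff n n>0 a ≡ + 2 → HasDistinctSolution n a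
  -- A prime modulo which `a` is constant divides the gcd 2, hence is 2; every weight is odd because
  -- T is odd.
  solve₃ n%4≡2 odd g≡2 = hasSolution n a λ {p} pp p∣n const π p∣w →
    2∤weight π (subst (λ q → + q ∣ weight n a π)
      (prime∣prime⇒≡ pp prime[2] (∣⇒∣ᵤ (subst (+ p ∣_) g≡2 (const⇒∣gcdDiff p∣n const)))) p∣w)
    where
    2∤weight : ∀ π → ¬ + 2 ∣ weight n a π
    2∤weight π 2∣w = 2∤1 (∣-−-subst 1ℤ (weight n a π) (∣-−-sym (weight n a π) 1ℤ
      (∣-−-trans (weight n a π) (triangle n) 1ℤ (weight-parity n a odd π) (triangle-odd n n%4≡2))) 2∣w)
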